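{- For every integer $k\ge 2$: (i) $c''_k=c''_{\le k}$, and (ii) $c''_k=c'_k\cdot (k/2)$.
   Context: All digraphs are finite. An oriented multigraph is a directed multigraph (parallel arcs allowed) without loops and without directed cycles of length 2; arcs are counted with multiplicity. For an oriented multigraph $D$, $n$ denotes its number of vertices and $m$ its number of arcs. The degree of a vertex is the number of arcs incident with it (the sum of its out-degree and in-degree, counted with multiplicity), $\Delta(D)$ is the maximum degree, and $D$ is degree-$k$ if every vertex has degree exactly $k$. $\mathrm{fas}(D)$ is the minimum number of arcs in a feedback arc set of $D$, i.e. in a set $F$ of arcs such that $D-F$ has no directed cycle. Let $c''_{\le k}$ be the infimum of all reals $c$ such that $\mathrm{fas}(D)\le c\cdot n$ holds for all oriented multigraphs $D$ with $\Delta(D)\le k$. Let $c'_k$ (respectively $c''_k$) be the infimum of all reals $c$ such that $\mathrm{fas}(D)\le c\cdot m$ (respectively $\mathrm{fas}(D)\le c\cdot n$) holds for all degree-$k$ oriented multigraphs $D$. -}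

module Defs where

import Algebra.Properties.CommutativeMonoid.Sum
open import Data.Fin.Base as Fin using (Fin; zero; suc; toℕ; fromℕ<)
open import Data.Fin.Properties as Fin using (all?; any?; injective⇒≤; toℕ-fromℕ<; toℕ≤pred[n])
open import Data.Integer.Base as ℤ using (+_)
import Data.Integer.Properties as ℤ
open import Data.Nat.Base as ℕ using (ℕ; zero; suc; z≤n; s≤s)
open import Data.Nat.DivMod using (_mod_)
import Data.Nat.Properties as ℕ
open import Data.Product.Base using (∃; ∃-syntax; _×_; _,_; proj₁; proj₂)
open import Data.Rational.Base as ℚ using (ℚ; 0ℚ; 1ℚ)
import Data.Rational.Properties as ℚ
open import Data.Rational.Unnormalised.Base as ℚᵘ using (mkℚᵘ)
import Data.Rational.Unnormalised.Properties as ℚᵘ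
open import Data.Vec.Functional using (foldr)
open import Function.Base using (_∘_)
open import Function.Definitions using (Injective)
open import Level using (Level; _⊔_; 0ℓ) renaming (suc to lsuc)
open import Relation.Binary.Core using (Rel)
open import Relation.Binary.PropositionalEquality
open import Relation.Nullary using (¬_; Dec; yes; no; contradiction)
open import Relation.Nullary.Decidable using (map′; _×-dec_; _→-dec_; ¬?)
open import Relation.Unary using (Decidable)

open Algebra.Properties.CommutativeMonoid.Sum ℕ.+-0-commutativeMonoid using (sum; sum-cong-≗)

private variable
  a b : Level

------------------------------------------------------------------------
-- Real numbers

-- A real number x is given by its upper Dedekind cut, the set of rationals q
-- with x < q.  Classically every real arises from exactly one such cut.  The
-- level of the cut is kept as a parameter because the infimum of a set of
-- reals is the union of their cuts, and hence lives one universe higher.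
record ℝ (a : Level) : Set (lsuc a) where
  field
    Above     : ℚ → Set a
    inhabited : ∃ Above
    bounded   : ∃[ p ] (∀ q → Above q → p ℚ.≤ q)
    upward    : ∀ {p q} → p ℚ.< q → Above p → Above q
    rounded   : ∀ {q} → Above q → ∃[ p ] p ℚ.< q × Above p

open ℝ

infix 4 _≤_ _≃_

_≤_ : ℝ a → ℝ b → Set (a ⊔ b)
x ≤ y = ∀ q → Above y q → Above x q

_≃_ : ℝ a → ℝ b → Set (a ⊔ b)
x ≃ y = x ≤ y × y ≤ x

private
  p<p+1 : ∀ p → p ℚ.< p ℚ.+ 1ℚ
  p<p+1 p = subst (ℚ._< p ℚ.+ 1ℚ) (ℚ.+-identityʳ p) (ℚ.+-monoʳ-< p (ℚ.positive⁻¹ 1ℚ))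

fromℚ : ℚ → ℝ 0ℓ
fromℚ p = record
  { Above     = p ℚ.<_
  ; inhabited = p ℚ.+ 1ℚ , p<p+1 p
  ; bounded   = p , λ _ → ℚ.<⇒≤
  ; upward    = λ q<r p<q → ℚ.<-trans p<q q<r
  ; rounded   = λ p<q → let r , p<r , r<q = ℚ.<-dense p<q in r , r<q , p<r
  }

fromℕ : ℕ → ℝ 0ℓ
fromℕ n = fromℚ (+ n ℚ./ 1)

infix 7 _·_/_

-- Product of the real x and the rational n / d: it is below q iff
-- p * (n / d) < q for some rational p > x.  (For n = 0 this is the cut of 0.)
_·_/_ : ℝ a → ℕ → (d : ℕ) → .{{ℕ.NonZero d}} → ℝ a
x · n / d = record
  { Above     = λ q → ∃[ p ] Above x p × p ℚ.* r ℚ.< q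
  ; inhabited = let p , x<p = inhabited x in p ℚ.* r ℚ.+ 1ℚ , p , x<p , p<p+1 (p ℚ.* r)
  ; bounded   = let l , l≤ = bounded x in l ℚ.* r , λ { q (p , x<p , pr<q) →
                  ℚ.≤-trans (ℚ.*-monoʳ-≤-nonNeg r {{ℚ.normalize-nonNeg n d}} (l≤ p x<p)) (ℚ.<⇒≤ pr<q) }
  ; upward    = λ { q<q′ (p , x<p , pr<q) → p , x<p , ℚ.<-trans pr<q q<q′ }
  ; rounded   = λ { (p , x<p , pr<q) →
                  let q′ , pr<q′ , q′<q = ℚ.<-dense pr<q in q′ , q′<q , p , x<p , pr<q′ }
  }
  where r = + n ℚ./ d

LowerBound : ℝ b → (ℝ 0ℓ → Set a) → Set (lsuc 0ℓ ⊔ a ⊔ b)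
LowerBound l S = ∀ x → S x → l ≤ x

inf : (S : ℝ 0ℓ → Set a) → ∃ S → ∃[ l ] LowerBound (fromℚ l) S → ℝ (lsuc 0ℓ ⊔ a)
inf S (x₀ , x₀∈S) (l , l≤S) = record
  { Above     = λ q → ∃[ x ] S x × Above x q
  ; inhabited = let q , x₀<q = inhabited x₀ in q , x₀ , x₀∈S , x₀<q
  ; bounded   = l , λ { q (x , x∈S , x<q) → ℚ.<⇒≤ (l≤S x x∈S q x<q) }
  ; upward    = λ { p<q (x , x∈S , x<p) → x , x∈S , upward x p<q x<p }
  ; rounded   = λ { (x , x∈S , x<q) → let p , p<q , x<p = rounded x x<q in p , p<q , x , x∈S , x<p }
  }

inf-lowerBound : (S : ℝ 0ℓ → Set a) (i : ∃ S) (l : ∃[ l ] LowerBound (fromℚ l) S) →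
                 LowerBound (inf S i l) S
inf-lowerBound S i l x x∈S q x<q = x , x∈S , x<q

inf-greatest : (S : ℝ 0ℓ → Set a) (i : ∃ S) (l : ∃[ l ] LowerBound (fromℚ l) S) →
               (y : ℝ b) → LowerBound y S → y ≤ inf S i l
inf-greatest S i l y y≤S q (x , x∈S , x<q) = y≤S x x∈S q x<q

------------------------------------------------------------------------
-- Oriented multigraphs

-- Parallel arcs are represented by their multiplicity: mult u v is the number
-- of arcs from u to v.
record OrientedMultigraph : Set where
  field
    order    : ℕ
    mult     : Fin order → Fin order → ℕ
    loopless : ∀ v → mult v v ≡ 0
    no2Cycle : ∀ u v → ¬ (0 ℕ.< mult u v × 0 ℕ.< mult v u)

  Vertex : Set
  Vertex = Fin order

  size : ℕ
  size = sum λ u → sum λ v → mult u v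

  outDegree inDegree degree : Vertex → ℕ
  outDegree v = sum λ w → mult v w
  inDegree  v = sum λ u → mult u v
  degree    v = outDegree v ℕ.+ inDegree v

  maxDegree : ℕ
  maxDegree = foldr ℕ._⊔_ 0 degree

open OrientedMultigraph

IsDegree : ℕ → OrientedMultigraph → Set
IsDegree k D = ∀ v → degree D v ≡ k

next : ∀ {l} → Fin (suc l) → Fin (suc l)
next {l} i = suc (toℕ i) mod suc l

record DirectedCycle (D : OrientedMultigraph) : Set where
  field
    pred-length : ℕ
    vertex      : Fin (suc pred-length) → Vertex D
    distinct    : Injective _≡_ _≡_ vertex
    arc         : ∀ i → 0 ℕ.< mult D (vertex i) (vertex (next i))

open DirectedCycle

Acyclic : OrientedMultigraph → Set
Acyclic D = ¬ DirectedCycle D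

-- A set of arcs of D, given by the number of arcs it contains from u to v.
-- Which of the parallel arcs are chosen is immaterial.
record ArcSet (D : OrientedMultigraph) : Set where
  field
    count  : Vertex D → Vertex D → ℕ
    count≤ : ∀ u v → count u v ℕ.≤ mult D u v

open ArcSet

∣_∣ : ∀ {D} → ArcSet D → ℕ
∣ F ∣ = sum λ u → sum λ v → count F u v

infixl 6 _−_

_−_ : (D : OrientedMultigraph) → ArcSet D → OrientedMultigraph
D − F = record
  { order    = order D
  ; mult     = λ u v → mult D u v ℕ.∸ count F u v
  ; loopless = λ v → ℕ.n≤0⇒n≡0 (subst
      (mult D v v ℕ.∸ count F v v ℕ.≤_) (loopless D v)
      (ℕ.m∸n≤m (mult D v v) (count F v v)))
  ; no2Cycle = λ { u v (uv , vu) → no2Cycle D u v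
                 ( ℕ.≤-trans uv (ℕ.m∸n≤m _ (count F u v))
                 , ℕ.≤-trans vu (ℕ.m∸n≤m _ (count F v u))) }
  }

IsFeedbackArcSet : (D : OrientedMultigraph) → ArcSet D → Set
IsFeedbackArcSet D F = Acyclic (D − F)

IsMinFAS : OrientedMultigraph → ℕ → Set
IsMinFAS D s = (∃[ F ] IsFeedbackArcSet D F × ∣ F ∣ ≡ s)
             × (∀ F → IsFeedbackArcSet D F → s ℕ.≤ ∣ F ∣)

private
  Exhaustible : (A : Set) → Rel A 0ℓ → Set₁
  Exhaustible A _≈_ = (P : A → Set) → (∀ {x y} → x ≈ y → P x → P y) → Decidable P → Dec (∃ P)

  exhaustFin : ∀ n → Exhaustible (Fin n) _≡_
  exhaustFin n P _ P? = any? P?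

  exhaustΠ : ∀ n {A : Fin n → Set} (R : ∀ i → Rel (A i) 0ℓ) → (∀ i {x} → R i x x) →
             (∀ i → Exhaustible (A i) (R i)) →
             Exhaustible (∀ i → A i) (λ f g → ∀ i → R i (f i) (g i))
  exhaustΠ zero {A} R rfl ex P resp P? =
    map′ (empty ,_) (λ { (f , p) → resp {f} {empty} (λ ()) p }) (P? empty)
    where
    empty : ∀ i → A i
    empty ()
  exhaustΠ (suc n) {A} R rfl ex P resp P? =
    map′ (λ { (x , f , p) → cons x f , p })
         (λ { (f , p) → f zero , f ∘ suc , resp (λ { zero → rfl zero ; (suc i) → rfl (suc i) }) p })
         (ex zero _ (λ { x≈y (f , p) → f , resp (λ { zero → x≈y ; (suc i) → rfl (suc i) }) p })
           λ x → exhaustΠ n (R ∘ suc) (rfl ∘ suc) (ex ∘ suc) _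
             (λ f≈g → resp (λ { zero → rfl zero ; (suc i) → f≈g i }))
             λ f → P? (cons x f))
    where
    cons : A zero → (∀ i → A (suc i)) → ∀ i → A i
    cons x f zero    = x
    cons x f (suc i) = f i

  least : {P : ℕ → Set} → Decidable P → ∀ n → P n → ∃[ s ] P s × (∀ t → P t → s ℕ.≤ t)
  least P? n p with P? 0
  ... | yes p₀ = 0 , p₀ , λ _ _ → z≤n
  least P? zero p | no ¬p₀ = contradiction p ¬p₀
  least P? (suc n) p | no ¬p₀ =
    let s , ps , s≤ = least (P? ∘ suc) n p in
    suc s , ps , λ { zero p₀ → contradiction p₀ ¬p₀ ; (suc t) pt → s≤s (s≤ t pt) }

  directedCycle? : ∀ D → Dec (DirectedCycle D)
  directedCycle? D = map′
    (λ { (l , f , d , h) → record { pred-length = toℕ l ; vertex = f ; distinct = λ {x} {y} → d x y ; arc = h } })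
    (λ C → fromℕ< (injective⇒≤ (distinct C)) ,
      subst IsCycle (sym (toℕ-fromℕ< (injective⇒≤ (distinct C))))
        (vertex C , (λ x y → distinct C) , arc C))
    (any? λ l → exhaustΠ (suc (toℕ l)) (λ _ → _≡_) (λ _ → refl) (λ _ → exhaustFin _) _
      (λ { {f} {g} f≗g (d , h) →
           (λ x y gx≡gy → d x y (trans (f≗g x) (trans gx≡gy (sym (f≗g y)))))
         , (λ i → subst₂ (λ u v → 0 ℕ.< mult D u v) (f≗g i) (f≗g (next i)) (h i)) })
      λ f → all? (λ x → all? λ y → (f x Fin.≟ f y) →-dec (x Fin.≟ y))
            ×-dec all? (λ i → 0 ℕ.<? mult D (f i) (f (next i))))
    where
    IsCycle : ℕ → Set
    IsCycle l = ∃ λ (f : Fin (suc l) → Vertex D) →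
      (∀ x y → f x ≡ f y → x ≡ y) × (∀ i → 0 ℕ.< mult D (f i) (f (next i)))

  module _ (D : OrientedMultigraph) where

    FASOfSize : ℕ → ArcSet D → Set
    FASOfSize s F = IsFeedbackArcSet D F × ∣ F ∣ ≡ s

    FASOfSize-resp : ∀ {s} F G → (∀ u v → count F u v ≡ count G u v) → FASOfSize s F → FASOfSize s G
    FASOfSize-resp F G F≗G (acyclic , size≡) =
      (λ C → acyclic record
        { vertex = vertex C ; distinct = distinct C
        ; arc = λ i → subst (λ t → 0 ℕ.< mult D _ _ ℕ.∸ t) (sym (F≗G _ _)) (arc C i) })
      , trans (sum-cong-≗ λ u → sum-cong-≗ λ v → sym (F≗G u v)) size≡

    Code : Set
    Code = ∀ u v → Fin (suc (mult D u v))

    decode : Code → ArcSet D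
    decode e = record { count = λ u v → toℕ (e u v) ; count≤ = λ u v → toℕ≤pred[n] (e u v) }

    fasOfSize? : ∀ s → Dec (∃ (FASOfSize s))
    fasOfSize? s = map′
      (λ { (e , p) → decode e , p })
      (λ { (F , p) → (λ u v → fromℕ< (s≤s (count≤ F u v)))
         , FASOfSize-resp F (decode λ u v → fromℕ< (s≤s (count≤ F u v)))
             (λ u v → sym (toℕ-fromℕ< (s≤s (count≤ F u v)))) p })
      (exhaustΠ _ (λ _ f g → ∀ v → f v ≡ g v) (λ _ _ → refl)
        (λ _ → exhaustΠ _ (λ _ → _≡_) (λ _ → refl) (λ _ → exhaustFin _)) _
        (λ {e} {e′} e≗e′ → FASOfSize-resp (decode e) (decode e′) (λ u v → cong toℕ (e≗e′ u v)))
        λ e → ¬? (directedCycle? (D − decode e)) ×-dec (∣ decode e ∣ ℕ.≟ s))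

    allArcs : ArcSet D
    allArcs = record { count = mult D ; count≤ = λ _ _ → ℕ.≤-refl }

    allArcs-fas : IsFeedbackArcSet D allArcs
    allArcs-fas C = ℕ.n≮0 (subst (0 ℕ.<_) (ℕ.n∸n≡0 (mult D _ _)) (arc C zero))

abstract
  minFAS : ∀ D → ∃ (IsMinFAS D)
  minFAS D =
    let s , attained , minimal = least (fasOfSize? D) (size D) (allArcs D , allArcs-fas D , refl) in
    s , attained , λ F isFAS → minimal ∣ F ∣ (F , isFAS , refl)

fas : OrientedMultigraph → ℕ
fas D = proj₁ (minFAS D)

fas-isMin : ∀ D → IsMinFAS D (fas D)
fas-isMin D = proj₂ (minFAS D)

------------------------------------------------------------------------
-- The three constants

Bound″≤ Bound″ Bound′ : ℕ → ℝ 0ℓ → Set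
Bound″≤ k c = ∀ D → maxDegree D ℕ.≤ k → fromℕ (fas D) ≤ c · order D / 1
Bound″  k c = ∀ D → IsDegree k D      → fromℕ (fas D) ≤ c · order D / 1
Bound′  k c = ∀ D → IsDegree k D      → fromℕ (fas D) ≤ c · size D / 1

-- The sets are inhabited because fas D ≤ m ≤ k * n, and bounded below by 0
-- because of the graph with two vertices joined by k parallel arcs.
private
  fas≤size : ∀ D → fas D ℕ.≤ size D
  fas≤size D = proj₂ (fas-isMin D) (allArcs D) (allArcs-fas D)

  sum≤ : ∀ {k} n (f : Fin n → ℕ) → (∀ i → f i ℕ.≤ k) → sum f ℕ.≤ k ℕ.* n
  sum≤ {k} zero    f f≤ = z≤n
  sum≤ {k} (suc n) f f≤ = ℕ.≤-trans (ℕ.+-mono-≤ (f≤ zero) (sum≤ n (f ∘ suc) (f≤ ∘ suc)))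
                                    (ℕ.≤-reflexive (sym (ℕ.*-suc k n)))

  f≤max : ∀ n (f : Fin n → ℕ) i → f i ℕ.≤ foldr ℕ._⊔_ 0 f
  f≤max (suc n) f zero    = ℕ.m≤m⊔n _ _
  f≤max (suc n) f (suc i) = ℕ.≤-trans (f≤max n (f ∘ suc) i) (ℕ.m≤n⊔m _ _)

  max≤ : ∀ {k} n (f : Fin n → ℕ) → (∀ i → f i ℕ.≤ k) → foldr ℕ._⊔_ 0 f ℕ.≤ k
  max≤ zero    f f≤ = z≤n
  max≤ (suc n) f f≤ = ℕ.⊔-lub (f≤ zero) (max≤ n (f ∘ suc) (f≤ ∘ suc))

  size≤ : ∀ k D → maxDegree D ℕ.≤ k → size D ℕ.≤ k ℕ.* order D
  size≤ k D Δ≤k = sum≤ (order D) (outDegree D) λ v →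
    ℕ.≤-trans (ℕ.m≤m+n _ (inDegree D v)) (ℕ.≤-trans (f≤max _ (degree D) v) Δ≤k)

  IsDegree⇒maxDegree≤ : ∀ {k} D → IsDegree k D → maxDegree D ℕ.≤ k
  IsDegree⇒maxDegree≤ D reg = max≤ _ (degree D) λ v → ℕ.≤-reflexive (reg v)

  toℚᵘ-/1 : ∀ n → ℚ.toℚᵘ (+ n ℚ./ 1) ℚᵘ.≃ mkℚᵘ (+ n) 0
  toℚᵘ-/1 n = ℚ.toℚᵘ-fromℚᵘ (mkℚᵘ (+ n) 0)

  ≤*⇒≤*/1 : ∀ {x} y z → x ℕ.≤ y ℕ.* z → + x ℚ./ 1 ℚ.≤ (+ y ℚ./ 1) ℚ.* (+ z ℚ./ 1)
  ≤*⇒≤*/1 {x} y z x≤yz = ℚ.toℚᵘ-cancel-≤ (begin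
    ℚ.toℚᵘ (+ x ℚ./ 1)                            ≃⟨ toℚᵘ-/1 x ⟩
    mkℚᵘ (+ x) 0                                  ≤⟨ ℚᵘ.*≤* (ℤ.*-monoʳ-≤-nonNeg (+ 1) x≤yz′) ⟩
    mkℚᵘ (+ y) 0 ℚᵘ.* mkℚᵘ (+ z) 0                ≃⟨ ℚᵘ.*-cong (toℚᵘ-/1 y) (toℚᵘ-/1 z) ⟨
    ℚ.toℚᵘ (+ y ℚ./ 1) ℚᵘ.* ℚ.toℚᵘ (+ z ℚ./ 1)    ≃⟨ ℚ.toℚᵘ-homo-* (+ y ℚ./ 1) (+ z ℚ./ 1) ⟨
    ℚ.toℚᵘ ((+ y ℚ./ 1) ℚ.* (+ z ℚ./ 1))            ∎)
    where
    open ℚᵘ.≤-Reasoning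
    x≤yz′ : + x ℤ.≤ + y ℤ.* + z
    x≤yz′ = subst (+ x ℤ.≤_) (ℤ.pos-* y z) (ℤ.+≤+ x≤yz)

  ≤*⇒≤· : ∀ {x} y z → x ℕ.≤ y ℕ.* z → fromℕ x ≤ fromℕ y · z / 1
  ≤*⇒≤· y z x≤yz q (p , y<p , pz<q) = ℚ.≤-<-trans (≤*⇒≤*/1 y z x≤yz)
    (ℚ.≤-<-trans (ℚ.*-monoʳ-≤-nonNeg (+ z ℚ./ 1) {{ℚ.normalize-nonNeg z 1}} (ℚ.<⇒≤ y<p)) pz<q)

  fromℕ≤·⇒0≤ : ∀ x n .{{_ : ℕ.NonZero n}} (c : ℝ 0ℓ) → fromℕ x ≤ c · n / 1 → fromℚ 0ℚ ≤ c
  fromℕ≤·⇒0≤ x n@(suc _) c x≤cn q c<q =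
    let p , p<q , c<p = rounded c c<q
        pn<qn = ℚ.*-monoˡ-<-pos (+ n ℚ./ 1) {{ℚ.normalize-pos n 1}} p<q
        0<qn  = ℚ.≤-<-trans (ℚ.nonNegative⁻¹ (+ x ℚ./ 1) {{ℚ.normalize-nonNeg x 1}})
                  (x≤cn (q ℚ.* (+ n ℚ./ 1)) (p , c<p , pn<qn))
    in ℚ.*-cancelʳ-<-nonNeg (+ n ℚ./ 1) {{ℚ.normalize-nonNeg n 1}}
         (subst (ℚ._< q ℚ.* (+ n ℚ./ 1)) (sym (ℚ.*-zeroˡ (+ n ℚ./ 1))) 0<qn)

  parallel : ℕ → OrientedMultigraph
  parallel k = record
    { order    = 2
    ; mult     = λ { zero (suc zero) → k ; _ _ → 0 }
    ; loopless = λ { zero → refl ; (suc zero) → refl }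
    ; no2Cycle = λ { zero zero (() , _) ; zero (suc zero) (_ , ()) ; (suc zero) _ (() , _) }
    }

  parallel-degree : ∀ k → IsDegree k (parallel k)
  parallel-degree k zero       = trans (ℕ.+-identityʳ _) (ℕ.+-identityʳ k)
  parallel-degree k (suc zero) = ℕ.+-identityʳ k

  parallel-size : ∀ k → size (parallel k) ≡ k
  parallel-size k = trans (ℕ.+-identityʳ _) (ℕ.+-identityʳ k)

c″≤ : ℕ → ℝ (lsuc 0ℓ)
c″≤ k = inf (Bound″≤ k)
  (fromℕ k , λ D Δ≤k → ≤*⇒≤· k (order D) (ℕ.≤-trans (fas≤size D) (size≤ k D Δ≤k)))
  (0ℚ , λ c h → fromℕ≤·⇒0≤ (fas (parallel k)) 2 c
    (h (parallel k) (IsDegree⇒maxDegree≤ (parallel k) (parallel-degree k))))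

c″ : ℕ → ℝ (lsuc 0ℓ)
c″ k = inf (Bound″ k)
  (fromℕ k , λ D reg → ≤*⇒≤· k (order D) (ℕ.≤-trans (fas≤size D) (size≤ k D (IsDegree⇒maxDegree≤ D reg))))
  (0ℚ , λ c h → fromℕ≤·⇒0≤ (fas (parallel k)) 2 c (h (parallel k) (parallel-degree k)))

-- For k = 0 every real is a bound, so the infimum exists only for k ≥ 1.
c′ : (k : ℕ) → 1 ℕ.≤ k → ℝ (lsuc 0ℓ)
c′ k k≥1 = inf (Bound′ k)
  (fromℕ 1 , λ D _ → ≤*⇒≤· 1 (size D) (ℕ.≤-trans (fas≤size D) (ℕ.≤-reflexive (sym (ℕ.*-identityˡ _)))))
  (0ℚ , λ c h → fromℕ≤·⇒0≤ (fas (parallel k)) k {{ℕ.>-nonZero k≥1}} c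
    (subst (λ m → fromℕ (fas (parallel k)) ≤ c · m / 1) (parallel-size k) (h (parallel k) (parallel-degree k))))

{-# OPTIONS --safe #-}
-- For (i), take two disjoint copies of a graph D with Δ(D) ≤ k and join each
-- vertex v to its copy by k − deg v parallel arcs.  The result is a degree-k
-- oriented multigraph on 2n vertices, and a feedback arc set of it restricts to
-- one of each copy, so its fas is at least 2 fas(D).  For (ii), 2m = kn in a
-- degree-k multigraph.
module Submission where

open import Defs
open import Data.Nat.Base as ℕ using (ℕ)
open import Data.Nat.Properties as ℕ using ()
open import Data.Product.Base using (_×_)

import Algebra.Properties.CommutativeMonoid.Sum
open import Data.Bool.Base using (if_then_else_)
open import Data.Fin.Base using (Fin; zero; suc; _↑ˡ_; _↑ʳ_; splitAt; join)
open import Data.Fin.Properties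
  using (_≟_; splitAt-join; join-splitAt; ↑ˡ-injective; ↑ʳ-injective)
open import Data.Integer.Base as ℤ using (+_)
import Data.Integer.Properties as ℤ
open import Data.Nat.Base using (zero; suc; z≤n)
open import Data.Nat.Tactic.RingSolver using (solve-∀)
open import Data.Product.Base using (_,_; proj₂)
open import Data.Rational.Base as ℚ using ()
import Data.Rational.Properties as ℚ
open import Data.Rational.Unnormalised.Base as ℚᵘ using (mkℚᵘ)
import Data.Rational.Unnormalised.Properties as ℚᵘ
open import Data.Sum.Base using (_⊎_; inj₁; inj₂)
open import Data.Vec.Functional using (foldr)
open import Function.Base using (_∘_)
open import Function.Definitions using (Injective)
open import Level using (Level)
open import Relation.Binary.PropositionalEquality
open import Relation.Nullary using (¬_; does)

open Algebra.Properties.CommutativeMonoid.Sum ℕ.+-0-commutativeMonoid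
  using (sum; sum-cong-≗; sum-replicate-zero; ∑-distrib-+; ∑-comm)

open ℝ
open OrientedMultigraph
open DirectedCycle
open ArcSet

private variable
  a : Level

-- Finite sums and maxima of naturals.

sum-mono-≤ : ∀ {n} {f g : Fin n → ℕ} → (∀ i → f i ℕ.≤ g i) → sum f ℕ.≤ sum g
sum-mono-≤ {zero}  f≤g = z≤n
sum-mono-≤ {suc n} f≤g = ℕ.+-mono-≤ (f≤g zero) (sum-mono-≤ (f≤g ∘ suc))

sum-const : ∀ {n k} (f : Fin n → ℕ) → (∀ i → f i ≡ k) → sum f ≡ n ℕ.* k
sum-const {zero}  f f≡k = refl
sum-const {suc n} f f≡k = cong₂ ℕ._+_ (f≡k zero) (sum-const (f ∘ suc) (f≡k ∘ suc))

sum-+ : ∀ m n (f : Fin (m ℕ.+ n) → ℕ) → sum f ≡ sum (f ∘ (_↑ˡ n)) ℕ.+ sum (f ∘ (m ↑ʳ_))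
sum-+ zero    n f = refl
sum-+ (suc m) n f = trans (cong (f zero ℕ.+_) (sum-+ m n (f ∘ suc)))
                          (sym (ℕ.+-assoc (f zero) _ _))

-- Serves as the multiplicities of the arcs joining each vertex to its own copy: row sums give the
-- out-degree these arcs add, column sums the in-degree.
diagonal : ∀ {n} → (Fin n → ℕ) → Fin n → Fin n → ℕ
diagonal f i j = if does (i ≟ j) then f i else 0

sum-diagonalʳ : ∀ {n} (f : Fin n → ℕ) i → sum (diagonal f i) ≡ f i
sum-diagonalʳ {suc n} f zero    = trans (cong (f zero ℕ.+_) (sum-replicate-zero n)) (ℕ.+-identityʳ _)
sum-diagonalʳ         f (suc i) = sum-diagonalʳ (f ∘ suc) i

sum-diagonalˡ : ∀ {n} (f : Fin n → ℕ) j → sum (λ i → diagonal f i j) ≡ f j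
sum-diagonalˡ {suc n} f zero    = trans (cong (f zero ℕ.+_) (sum-replicate-zero n)) (ℕ.+-identityʳ _)
sum-diagonalˡ         f (suc j) = sum-diagonalˡ (f ∘ suc) j

lookup≤max : ∀ {n} (f : Fin n → ℕ) i → f i ℕ.≤ foldr ℕ._⊔_ 0 f
lookup≤max f zero    = ℕ.m≤m⊔n _ _
lookup≤max f (suc i) = ℕ.≤-trans (lookup≤max (f ∘ suc) i) (ℕ.m≤n⊔m _ _)

max≤ : ∀ {n k} (f : Fin n → ℕ) → (∀ i → f i ℕ.≤ k) → foldr ℕ._⊔_ 0 f ℕ.≤ k
max≤ {zero}  f f≤k = z≤n
max≤ {suc n} f f≤k = ℕ.⊔-lub (f≤k zero) (max≤ (f ∘ suc) (f≤k ∘ suc))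

-- Degree counting.

IsDegree⇒maxDegree≤ : ∀ {k} D → IsDegree k D → maxDegree D ℕ.≤ k
IsDegree⇒maxDegree≤ D reg = max≤ (degree D) (ℕ.≤-reflexive ∘ reg)

-- An arc counts once at its tail and once at its head; the in-degrees add up to `size` after
-- exchanging the two summations.
handshake : ∀ D → sum (degree D) ≡ size D ℕ.+ size D
handshake D = trans (∑-distrib-+ (outDegree D) (inDegree D))
                    (cong (size D ℕ.+_) (sym (∑-comm (mult D))))

IsDegree⇒size : ∀ {k} D → IsDegree k D → size D ℕ.+ size D ≡ order D ℕ.* k
IsDegree⇒size D reg = trans (sym (handshake D)) (sum-const (degree D) reg)

-- Pulling back feedback arc sets along induced embeddings.

module Restriction (D E : OrientedMultigraph) (ι : Vertex D → Vertex E)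
                   (ι-injective : Injective _≡_ _≡_ ι)
                   (ι-mult : ∀ u v → mult E (ι u) (ι v) ≡ mult D u v) where

  restrict : ArcSet E → ArcSet D
  restrict F = record
    { count  = λ u v → count F (ι u) (ι v)
    ; count≤ = λ u v → subst (count F (ι u) (ι v) ℕ.≤_) (ι-mult u v) (count≤ F (ι u) (ι v))
    }

  -- Multiplicities agree along `ι`, so an arc left in `D − restrict F` maps to one left in `E − F`;
  -- injectivity keeps the vertices of a cycle distinct.
  restrict-fas : ∀ F → IsFeedbackArcSet E F → IsFeedbackArcSet D (restrict F)
  restrict-fas F acyclic C = acyclic record
    { vertex   = ι ∘ vertex C
    ; distinct = distinct C ∘ ι-injective
    ; arc      = λ i → subst (λ t → 0 ℕ.< t ℕ.∸ count F _ _) (sym (ι-mult _ _)) (arc C i)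
    }

-- The degree-k double of a multigraph.

module Doubling (k : ℕ) (D : OrientedMultigraph) where

  n = order D

  deficiency : Vertex D → ℕ
  deficiency v = k ℕ.∸ degree D v

  -- Indexing by the sum type separates the two copies. All joining arcs run from the first copy to
  -- the second, which rules out 2-cycles through them.
  mult⊎ : Vertex D ⊎ Vertex D → Vertex D ⊎ Vertex D → ℕ
  mult⊎ (inj₁ u) (inj₁ v) = mult D u v
  mult⊎ (inj₁ u) (inj₂ v) = diagonal deficiency u v
  mult⊎ (inj₂ u) (inj₁ v) = 0
  mult⊎ (inj₂ u) (inj₂ v) = mult D u v

  double : OrientedMultigraph
  double = record
    { order    = n ℕ.+ n
    ; mult     = λ u v → mult⊎ (splitAt n u) (splitAt n v)
    ; loopless = λ v → mult⊎-loopless (splitAt n v)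
    ; no2Cycle = λ u v → mult⊎-no2Cycle (splitAt n u) (splitAt n v)
    }
    where
    mult⊎-loopless : ∀ v → mult⊎ v v ≡ 0
    mult⊎-loopless (inj₁ v) = loopless D v
    mult⊎-loopless (inj₂ v) = loopless D v

    mult⊎-no2Cycle : ∀ u v → ¬ (0 ℕ.< mult⊎ u v × 0 ℕ.< mult⊎ v u)
    mult⊎-no2Cycle (inj₁ u) (inj₁ v) = no2Cycle D u v
    mult⊎-no2Cycle (inj₁ u) (inj₂ v) (_ , ())
    mult⊎-no2Cycle (inj₂ u) (inj₁ v) (() , _)
    mult⊎-no2Cycle (inj₂ u) (inj₂ v) = no2Cycle D u v

  mult-join : ∀ s t → mult double (join n n s) (join n n t) ≡ mult⊎ s t
  mult-join s t = cong₂ mult⊎ (splitAt-join n n s) (splitAt-join n n t)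

  -- `splitAt` is stuck on a variable index, so sums over the vertices of `double` are evaluated
  -- copy by copy through `join`.
  sum-mult⊎ : ∀ (f : Vertex double → ℕ) (g : Vertex D ⊎ Vertex D → ℕ) →
              (∀ s → f (join n n s) ≡ g s) → sum f ≡ sum (g ∘ inj₁) ℕ.+ sum (g ∘ inj₂)
  sum-mult⊎ f g f≗g = trans (sum-+ n n f)
    (cong₂ ℕ._+_ (sum-cong-≗ (f≗g ∘ inj₁)) (sum-cong-≗ (f≗g ∘ inj₂)))

  -- The joining arcs add `deficiency v` to the out-degree of v in the first copy and to its
  -- in-degree in the second.
  degree-join : (∀ v → degree D v ℕ.≤ k) → ∀ s → degree double (join n n s) ≡ k
  degree-join deg≤k s@(inj₁ v) = begin
    degree double (v ↑ˡ n)
      ≡⟨ cong₂ ℕ._+_ (sum-mult⊎ _ (mult⊎ s) (mult-join s))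
                     (sum-mult⊎ _ (λ t → mult⊎ t s) (λ t → mult-join t s)) ⟩
    (outDegree D v ℕ.+ sum (diagonal deficiency v)) ℕ.+ (inDegree D v ℕ.+ sum {n} (λ _ → 0))
      ≡⟨ cong₂ (λ x y → (outDegree D v ℕ.+ x) ℕ.+ (inDegree D v ℕ.+ y))
               (sum-diagonalʳ deficiency v) (sum-replicate-zero n) ⟩
    (outDegree D v ℕ.+ deficiency v) ℕ.+ (inDegree D v ℕ.+ 0)
      ≡⟨ rearrange (outDegree D v) (deficiency v) (inDegree D v) ⟩
    degree D v ℕ.+ deficiency v
      -- `deg≤k` makes the truncated subtraction in `deficiency` exact.
      ≡⟨ ℕ.m+[n∸m]≡n (deg≤k v) ⟩
    k ∎
    where
    open ≡-Reasoning
    rearrange : ∀ x y z → (x ℕ.+ y) ℕ.+ (z ℕ.+ 0) ≡ (x ℕ.+ z) ℕ.+ y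
    rearrange = solve-∀
  degree-join deg≤k s@(inj₂ v) = begin
    degree double (n ↑ʳ v)
      ≡⟨ cong₂ ℕ._+_ (sum-mult⊎ _ (mult⊎ s) (mult-join s))
                     (sum-mult⊎ _ (λ t → mult⊎ t s) (λ t → mult-join t s)) ⟩
    (sum {n} (λ _ → 0) ℕ.+ outDegree D v) ℕ.+ (sum (λ u → diagonal deficiency u v) ℕ.+ inDegree D v)
      ≡⟨ cong₂ (λ x y → (x ℕ.+ outDegree D v) ℕ.+ (y ℕ.+ inDegree D v))
               (sum-replicate-zero n) (sum-diagonalˡ deficiency v) ⟩
    outDegree D v ℕ.+ (deficiency v ℕ.+ inDegree D v)
      ≡⟨ rearrange (outDegree D v) (deficiency v) (inDegree D v) ⟩
    degree D v ℕ.+ deficiency v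
      ≡⟨ ℕ.m+[n∸m]≡n (deg≤k v) ⟩
    k ∎
    where
    open ≡-Reasoning
    rearrange : ∀ x y z → x ℕ.+ (y ℕ.+ z) ≡ (x ℕ.+ z) ℕ.+ y
    rearrange = solve-∀

  double-degree : maxDegree D ℕ.≤ k → IsDegree k double
  double-degree Δ≤k v = subst (λ w → degree double w ≡ k) (join-splitAt n n v)
    (degree-join (λ u → ℕ.≤-trans (lookup≤max (degree D) u) Δ≤k) (splitAt n v))

  module Left  = Restriction D double (_↑ˡ n) (↑ˡ-injective n _ _) (λ u v → mult-join (inj₁ u) (inj₁ v))
  module Right = Restriction D double (n ↑ʳ_) (↑ʳ-injective n _ _) (λ u v → mult-join (inj₂ u) (inj₂ v))

  -- The restrictions count disjoint blocks of `count F`; each row loses only the half that counts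
  -- arcs between the copies.
  ∣restrict∣≤ : ∀ F → ∣ Left.restrict F ∣ ℕ.+ ∣ Right.restrict F ∣ ℕ.≤ ∣ F ∣
  ∣restrict∣≤ F = begin
    ∣ Left.restrict F ∣ ℕ.+ ∣ Right.restrict F ∣
      ≤⟨ ℕ.+-mono-≤
           (sum-mono-≤ λ u → ℕ.≤-trans (ℕ.m≤m+n _ _) (ℕ.≤-reflexive (sym (sum-+ n n (count F (u ↑ˡ n))))))
           (sum-mono-≤ λ u → ℕ.≤-trans (ℕ.m≤n+m _ _) (ℕ.≤-reflexive (sym (sum-+ n n (count F (n ↑ʳ u)))))) ⟩
    sum (λ u → sum (count F (u ↑ˡ n))) ℕ.+ sum (λ u → sum (count F (n ↑ʳ u)))
      ≡⟨ sum-+ n n (λ u → sum (count F u)) ⟨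
    ∣ F ∣ ∎
    where open ℕ.≤-Reasoning

  fas-double : fas D ℕ.+ fas D ℕ.≤ fas double
  fas-double = let (F , F-fas , ∣F∣≡) , _ = fas-isMin double in begin
    fas D ℕ.+ fas D
      ≤⟨ ℕ.+-mono-≤ (minimal (Left.restrict F) (Left.restrict-fas F F-fas))
                    (minimal (Right.restrict F) (Right.restrict-fas F F-fas)) ⟩
    ∣ Left.restrict F ∣ ℕ.+ ∣ Right.restrict F ∣
      ≤⟨ ∣restrict∣≤ F ⟩
    ∣ F ∣
      ≡⟨ ∣F∣≡ ⟩
    fas double ∎
    where
    open ℕ.≤-Reasoning
    minimal = proj₂ (fas-isMin D)

open Doubling using (double; double-degree; fas-double)

-- Arithmetic of fractions.

/1-mono-≤ : ∀ {m n} → m ℕ.≤ n → + m ℚ./ 1 ℚ.≤ + n ℚ./ 1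
/1-mono-≤ {m} {n} m≤n = ℚ.toℚᵘ-cancel-≤ (begin
  ℚ.toℚᵘ (+ m ℚ./ 1)  ≃⟨ ℚ.toℚᵘ-fromℚᵘ (mkℚᵘ (+ m) 0) ⟩
  mkℚᵘ (+ m) 0        ≤⟨ ℚᵘ.*≤* (ℤ.*-monoʳ-≤-nonNeg (+ 1) (ℤ.+≤+ m≤n)) ⟩
  mkℚᵘ (+ n) 0        ≃⟨ ℚ.toℚᵘ-fromℚᵘ (mkℚᵘ (+ n) 0) ⟨
  ℚ.toℚᵘ (+ n ℚ./ 1)  ∎)
  where open ℚᵘ.≤-Reasoning

-- Normalised fractions do not compute on open terms. Among unnormalised rationals the equation is a
-- cross-multiplication, which descends to naturals.
/*/≡/ : ∀ a b c d e f .{{_ : ℕ.NonZero b}} .{{_ : ℕ.NonZero d}} .{{_ : ℕ.NonZero f}} →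
        a ℕ.* c ℕ.* f ≡ e ℕ.* (b ℕ.* d) → (+ a ℚ./ b) ℚ.* (+ c ℚ./ d) ≡ + e ℚ./ f
/*/≡/ a b@(suc b-1) c d@(suc d-1) e f@(suc f-1) acf≡ebd = ℚ.toℚᵘ-injective (begin-equality
  ℚ.toℚᵘ ((+ a ℚ./ b) ℚ.* (+ c ℚ./ d))            ≃⟨ ℚ.toℚᵘ-homo-* (+ a ℚ./ b) (+ c ℚ./ d) ⟩
  ℚ.toℚᵘ (+ a ℚ./ b) ℚᵘ.* ℚ.toℚᵘ (+ c ℚ./ d)      ≃⟨ ℚᵘ.*-cong (ℚ.toℚᵘ-fromℚᵘ (mkℚᵘ (+ a) b-1))
                                                               (ℚ.toℚᵘ-fromℚᵘ (mkℚᵘ (+ c) d-1)) ⟩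
  mkℚᵘ (+ a) b-1 ℚᵘ.* mkℚᵘ (+ c) d-1              ≃⟨ ℚᵘ.*≡* cross ⟩
  mkℚᵘ (+ e) f-1                                  ≃⟨ ℚ.toℚᵘ-fromℚᵘ (mkℚᵘ (+ e) f-1) ⟨
  ℚ.toℚᵘ (+ e ℚ./ f)                              ∎)
  where
  open ℚᵘ.≤-Reasoning
  cross : + a ℤ.* + c ℤ.* + f ≡ + e ℤ.* + (b ℕ.* d)
  cross = trans (cong (ℤ._* + f) (sym (ℤ.pos-* a c)))
            (trans (sym (ℤ.pos-* (a ℕ.* c) f))
              (trans (cong +_ acf≡ebd) (ℤ.pos-* e (b ℕ.* d))))

-- Comparing naturals with multiples of a cut.

module _ {x n : ℕ} {c : ℝ a} where

  -- If p n < x, then x itself would lie in the cut of `c · n / 1`, hence in the open cut of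
  -- `fromℕ x`, giving x < x.
  ≤·⇒≤* : fromℕ x ≤ c · n / 1 → ∀ {p} → Above c p → + x ℚ./ 1 ℚ.≤ p ℚ.* (+ n ℚ./ 1)
  ≤·⇒≤* x≤cn c<p = ℚ.≮⇒≥ λ pn<x → ℚ.<-irrefl refl (x≤cn _ (_ , c<p , pn<x))

  ≤*⇒≤· : (∀ {p} → Above c p → + x ℚ./ 1 ℚ.≤ p ℚ.* (+ n ℚ./ 1)) → fromℕ x ≤ c · n / 1
  ≤*⇒≤· x≤pn q (p , c<p , pn<q) = ℚ.≤-<-trans (x≤pn c<p) pn<q

-- For q above `c · r / d` there is p above c with p (r / d) < q, so x ≤ p m = p (r / d) n ≤ q n.
-- This converts arc bounds and vertex bounds into each other.
≤·-rescale : ∀ {x m n r d} .{{_ : ℕ.NonZero d}} (c : ℝ a) →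
             (+ r ℚ./ d) ℚ.* (+ n ℚ./ 1) ≡ + m ℚ./ 1 →
             fromℕ x ≤ c · m / 1 → fromℕ x ≤ (c · r / d) · n / 1
≤·-rescale {x = x} {m} {n} {r} {d} c rn≡m x≤cm =
  ≤*⇒≤· {x = x} {n} {c · r / d} λ { {q} (p , c<p , pr<q) → begin
  + x ℚ./ 1                              ≤⟨ ≤·⇒≤* {x = x} {m} {c} x≤cm c<p ⟩
  p ℚ.* (+ m ℚ./ 1)                      ≡⟨ cong (p ℚ.*_) rn≡m ⟨
  p ℚ.* ((+ r ℚ./ d) ℚ.* (+ n ℚ./ 1))    ≡⟨ ℚ.*-assoc p _ _ ⟨
  p ℚ.* (+ r ℚ./ d) ℚ.* (+ n ℚ./ 1)      ≤⟨ ℚ.*-monoʳ-≤-nonNeg (+ n ℚ./ 1) {{ℚ.normalize-nonNeg n 1}} (ℚ.<⇒≤ pr<q) ⟩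
  q ℚ.* (+ n ℚ./ 1)                      ∎ }
  where open ℚ.≤-Reasoning

-- Both sides are multiplied by 2 so that the hypotheses chain; the factor is then cancelled.
≤·-halve : ∀ {x y n} (c : ℝ a) → x ℕ.+ x ℕ.≤ y → fromℕ y ≤ c · (n ℕ.+ n) / 1 → fromℕ x ≤ c · n / 1
≤·-halve {x = x} {y} {n} c 2x≤y y≤2cn = ≤*⇒≤· {x = x} {n} {c} λ {p} c<p → ℚ.*-cancelʳ-≤-pos (+ 2 ℚ./ 1) (begin
  (+ x ℚ./ 1) ℚ.* (+ 2 ℚ./ 1)            ≡⟨ *2 x ⟩
  + (x ℕ.+ x) ℚ./ 1                      ≤⟨ /1-mono-≤ 2x≤y ⟩
  + y ℚ./ 1                              ≤⟨ ≤·⇒≤* {x = y} {n ℕ.+ n} {c} y≤2cn c<p ⟩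
  p ℚ.* (+ (n ℕ.+ n) ℚ./ 1)              ≡⟨ cong (p ℚ.*_) (*2 n) ⟨
  p ℚ.* ((+ n ℚ./ 1) ℚ.* (+ 2 ℚ./ 1))    ≡⟨ ℚ.*-assoc p _ _ ⟨
  p ℚ.* (+ n ℚ./ 1) ℚ.* (+ 2 ℚ./ 1)      ∎)
  where
  open ℚ.≤-Reasoning
  double-rearrange : ∀ z → z ℕ.* 2 ℕ.* 1 ≡ (z ℕ.+ z) ℕ.* 1
  double-rearrange = solve-∀
  *2 : ∀ z → (+ z ℚ./ 1) ℚ.* (+ 2 ℚ./ 1) ≡ + (z ℕ.+ z) ℚ./ 1
  *2 z = /*/≡/ z 1 2 1 (z ℕ.+ z) 1 (double-rearrange z)

-- Transfer between the kinds of bounds.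

Bound″≤⇒Bound″ : ∀ {k} c → Bound″≤ k c → Bound″ k c
Bound″≤⇒Bound″ c bound D reg = bound D (IsDegree⇒maxDegree≤ D reg)

Bound″⇒Bound″≤ : ∀ {k} c → Bound″ k c → Bound″≤ k c
Bound″⇒Bound″≤ {k} c bound D Δ≤k = ≤·-halve {x = fas D} {n = order D} c (fas-double k D)
  (bound (double k D) (double-degree k D Δ≤k))

-- 2m = kn makes m equal to (k / 2) n.
Bound′⇒Bound″ : ∀ {k} c → Bound′ k c → Bound″ k (c · k / 2)
Bound′⇒Bound″ {k} c bound D reg =
  ≤·-rescale {x = fas D} {size D} {order D} {k} {2} c
    (/*/≡/ k 2 (order D) 1 (size D) 1 kn≡2m)
    (bound D reg)
  where
  left-rearrange : ∀ k n → k ℕ.* n ℕ.* 1 ≡ n ℕ.* k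
  left-rearrange = solve-∀
  right-rearrange : ∀ m → m ℕ.+ m ≡ m ℕ.* (2 ℕ.* 1)
  right-rearrange = solve-∀
  kn≡2m : k ℕ.* order D ℕ.* 1 ≡ size D ℕ.* (2 ℕ.* 1)
  kn≡2m = trans (left-rearrange k (order D)) (trans (sym (IsDegree⇒size D reg)) (right-rearrange (size D)))

-- The same count solved for n: n = (2 / k) m.
Bound″⇒Bound′ : ∀ {k} .{{_ : ℕ.NonZero k}} c → Bound″ k c → Bound′ k (c · 2 / k)
Bound″⇒Bound′ {k} c bound D reg =
  ≤·-rescale {x = fas D} {order D} {size D} {2} {k} c
    (/*/≡/ 2 k (size D) 1 (order D) 1 2m≡nk)
    (bound D reg)
  where
  left-rearrange : ∀ m → 2 ℕ.* m ℕ.* 1 ≡ m ℕ.+ m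
  left-rearrange = solve-∀
  2m≡nk : 2 ℕ.* size D ℕ.* 1 ≡ order D ℕ.* (k ℕ.* 1)
  2m≡nk = trans (left-rearrange (size D)) (trans (IsDegree⇒size D reg)
            (cong (order D ℕ.*_) (sym (ℕ.*-identityʳ k))))

proposition4 : (k : ℕ) (k≥2 : 2 ℕ.≤ k) →
    (c″ k ≃ c″≤ k) × (c″ k ≃ c′ k (ℕ.<⇒≤ k≥2) · k / 2)
-- Matching on `suc` supplies the nonzero instance for division by k.
proposition4 k@(suc _) k≥2 =
  -- The same c is a bound in both senses, so the witness is unchanged.
  ( (λ { q (c , bound , c<q) → c , Bound″≤⇒Bound″ c bound , c<q })
  , (λ { q (c , bound , c<q) → c , Bound″⇒Bound″≤ c bound , c<q })
  ) ,
  -- The given p already lies above c, so it also places q in the cut of `c · k / 2`.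
  ( (λ { q (p , (c , bound , c<p) , pk/2<q) → c · k / 2 , Bound′⇒Bound″ c bound , p , c<p , pk/2<q })
  , (λ { q (c , bound , c<q) →
      -- Roundedness leaves room for p strictly between q′ (2 / k) and q (2 / k): the lower end puts
      -- p above the arc bound `c · 2 / k`, the upper end gives p (k / 2) < q.
      let q′ , q′<q , c<q′ = rounded c c<q
          p , q′2/k<p , p<q2/k = ℚ.<-dense (ℚ.*-monoˡ-<-pos (+ 2 ℚ./ k) {{ℚ.normalize-pos 2 k}} q′<q)
      in p , (c · 2 / k , Bound″⇒Bound′ c bound , q′ , c<q′ , q′2/k<p)
       , subst (p ℚ.* (+ k ℚ./ 2) ℚ.<_) (cancel q)
           (ℚ.*-monoˡ-<-pos (+ k ℚ./ 2) {{ℚ.normalize-pos k 2}} p<q2/k) })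
  )
  where
  commute : ∀ k → 2 ℕ.* k ℕ.* 1 ≡ 1 ℕ.* (k ℕ.* 2)
  commute = solve-∀
  cancel : ∀ q → q ℚ.* (+ 2 ℚ./ k) ℚ.* (+ k ℚ./ 2) ≡ q
  cancel q = trans (ℚ.*-assoc q (+ 2 ℚ./ k) (+ k ℚ./ 2))
    (trans (cong (q ℚ.*_) (/*/≡/ 2 k k 2 1 1 (commute k))) (ℚ.*-identityʳ q))
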